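{- The unrestricted unification type of the equational theory $\mathcal{EL}$ (which axiomatizes equivalence of concept descriptions in the description logic $\mathcal{EL}$) for elementary unification is infinitary.
   Context: The theory $\mathcal{EL}$ (bounded semilattices with monotone operators): the signature $\Sigma$ consists of a binary function symbol $\sqcap$ (written infix), a constant $\top$, and a unary function symbol $\exists r.$ for each role name $r$ from a finite non-empty set of role names. The identities are $x\sqcap y\approx y\sqcap x$, $(x\sqcap y)\sqcap z\approx x\sqcap(y\sqcap z)$, $x\sqcap x\approx x$, $x\sqcap\top\approx x$, and, for each role name $r$, $\exists r.x\sqcap\exists r.(x\sqcap y)\approx\exists r.(x\sqcap y)$. Let $V$ be a countably infinite set of variables and $T(\Sigma,V)$ the set of terms. For an equational theory $E$, i.e., a set of (implicitly universally quantified) identities between terms, $\approx_E$ is the congruence relation on $T(\Sigma,V)$ it induces ($s\approx_E t$ iff $s\approx t$ holds in all models of $E$). A substitution is a map $\sigma:V\to T(\Sigma,V)$ with finite domain $\{x\in V\mid\sigma(x)\neq x\}$, extended homomorphically to terms. The unrestricted instantiation preorder $\leq_E^V$ is defined by: $\sigma\leq_E^V\tau$ iff there is a substitution $\lambda$ with $\lambda(\sigma(x))\approx_E\tau(x)$ for all $x\in V$. An $E$-unification problem is a finite set $\Gamma=\{s_1\approx_E^? t_1,\ldots,s_n\approx_E^? t_n\}$ of equations between terms in $T(\Sigma,V)$; elementary unification means that $\Sigma$ contains only function symbols occurring in $E$. An $E$-unifier of $\Gamma$ is a substitution $\sigma$ with $\sigma(s_i)\approx_E\sigma(t_i)$ for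 all $i$; $\Gamma$ is solvable if it has an $E$-unifier. A set $S$ of $E$-unifiers of $\Gamma$ is complete w.r.t. $\leq_E^V$ if for every $E$-unifier $\theta$ of $\Gamma$ there is $\sigma\in S$ with $\sigma\leq_E^V\theta$; it is minimal if no two distinct elements of $S$ are comparable w.r.t. $\leq_E^V$. Minimal complete sets of the same problem all have the same cardinality. The unrestricted unification type of a solvable $\Gamma$ is: unitary if $\Gamma$ has a minimal complete set (w.r.t. $\leq_E^V$) of cardinality one; finitary if it has a finite minimal complete set of cardinality greater than one; infinitary if it has an infinite minimal complete set; zero if it has no minimal complete set. Types are ordered by zero $>$ infinitary $>$ finitary $>$ unitary, and the unrestricted unification type of $E$ is the largest (worst) unrestricted type of any solvable $E$-unification problem. -}

module Defs where

open import Data.Fin.Base using (Fin)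
open import Data.List.Base using (List; length)
open import Data.List.Relation.Unary.All using (All)
import Data.List.Membership.Propositional as Propositional
import Data.List.Membership.Setoid as SetoidMembership
import Data.List.Relation.Unary.Unique.Setoid as SetoidUnique
open import Data.Nat.Base as ℕ using (ℕ)
open import Data.Product.Base using (∃; _×_; _,_)
open import Level using (0ℓ)
open import Relation.Binary.Bundles using (Setoid)
open import Relation.Binary.Core using (Rel)
import Relation.Binary.Construct.On as On
open import Relation.Binary.PropositionalEquality using (_≡_; _≢_; _→-setoid_)
open import Relation.Nullary.Negation using (¬_)
open import Relation.Unary using (Pred; _⊆_)

data UnificationType : Set where
  unitary finitary infinitary zero : UnificationType

rank : UnificationType → ℕ
rank unitary    = 0
rank finitary   = 1
rank infinitary = 2
rank zero       = 3

infix 4 _≤ᵗ_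
_≤ᵗ_ : Rel UnificationType 0ℓ
s ≤ᵗ t = rank s ℕ.≤ rank t

Var : Set
Var = ℕ

-- The role names are the n elements of Fin n.  The signature has no symbols
-- besides those occurring in the identities EL below, so all the unification
-- problems considered for EL are elementary.
module Unification (n : ℕ) where

  Role : Set
  Role = Fin n

  infixr 7 _⊓_
  infixr 8 ∃⟨_⟩_

  data Term : Set where
    var   : Var → Term
    ⊤     : Term
    _⊓_   : Term → Term → Term
    ∃⟨_⟩_ : Role → Term → Term

  extend : (Var → Term) → Term → Term
  extend f (var x)    = f x
  extend f ⊤          = ⊤
  extend f (s ⊓ t)    = extend f s ⊓ extend f t
  extend f (∃⟨ r ⟩ t) = ∃⟨ r ⟩ extend f t

  -- An equational theory is a set of identities, i.e. of pairs of terms whose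
  -- variables are read as universally quantified.
  Theory : Set₁
  Theory = Rel Term 0ℓ

  -- The congruence induced by E: the least congruence on terms containing all
  -- instances of the identities in E.  In `axiom`, f is an arbitrary map, with
  -- no finite-domain requirement.
  infix 4 _⊢_≈_
  data _⊢_≈_ (E : Theory) : Rel Term 0ℓ where
    axiom  : ∀ {s t} (f : Var → Term) → E s t → E ⊢ extend f s ≈ extend f t
    refl   : ∀ {s} → E ⊢ s ≈ s
    sym    : ∀ {s t} → E ⊢ s ≈ t → E ⊢ t ≈ s
    trans  : ∀ {s t u} → E ⊢ s ≈ t → E ⊢ t ≈ u → E ⊢ s ≈ u
    ⊓-cong : ∀ {s s′ t t′} → E ⊢ s ≈ s′ → E ⊢ t ≈ t′ → E ⊢ s ⊓ t ≈ s′ ⊓ t′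
    ∃-cong : ∀ {r t t′} → E ⊢ t ≈ t′ → E ⊢ ∃⟨ r ⟩ t ≈ ∃⟨ r ⟩ t′

  private
    x y z : Term
    x = var 0
    y = var 1
    z = var 2

  data EL : Theory where
    comm   : EL (x ⊓ y) (y ⊓ x)
    assoc  : EL ((x ⊓ y) ⊓ z) (x ⊓ (y ⊓ z))
    idem   : EL (x ⊓ x) x
    unit   : EL (x ⊓ ⊤) x
    mono   : ∀ r → EL (∃⟨ r ⟩ x ⊓ ∃⟨ r ⟩ (x ⊓ y)) (∃⟨ r ⟩ (x ⊓ y))

  open Propositional using (_∈_)

  record Substitution : Set where
    field
      fun          : Var → Term
      finiteDomain : ∃ λ (vs : List Var) → ∀ v → fun v ≢ var v → v ∈ vs

  open Substitution public

  infixr 9 _⟪_⟫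
  _⟪_⟫ : Substitution → Term → Term
  σ ⟪ t ⟫ = extend (fun σ) t

  -- Substitutions are identified when they agree as maps; this is the equality
  -- used below for distinctness and cardinality.
  substitutions : Setoid 0ℓ 0ℓ
  substitutions = On.setoid (Var →-setoid Term) fun

  open Setoid substitutions using () renaming (_≈_ to _≗ˢ_) public
  open SetoidMembership substitutions using () renaming (_∈_ to _∈ˢ_) public
  open SetoidUnique substitutions using (Unique) public

  -- The cardinality of S modulo _≗ˢ_; S need not be closed under _≗ˢ_.
  HasCardinality : Pred Substitution 0ℓ → ℕ → Set
  HasCardinality S k =
    ∃ λ (σs : List Substitution) →
      length σs ≡ k × Unique σs × All S σs × (∀ σ → S σ → σ ∈ˢ σs)

  Infinite : Pred Substitution 0ℓ → Set
  Infinite S = ¬ ∃ (HasCardinality S)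

  Problem : Set
  Problem = List (Term × Term)

  module _ (E : Theory) where

    -- The unrestricted instantiation preorder: all variables are compared.
    infix 4 _≤ⱽ_
    _≤ⱽ_ : Rel Substitution 0ℓ
    σ ≤ⱽ τ = ∃ λ (ρ : Substitution) → ∀ v → E ⊢ ρ ⟪ fun σ v ⟫ ≈ fun τ v

    Unifier : Problem → Pred Substitution 0ℓ
    Unifier Γ σ = All (λ (s , t) → E ⊢ σ ⟪ s ⟫ ≈ σ ⟪ t ⟫) Γ

    Solvable : Problem → Set
    Solvable Γ = ∃ (Unifier Γ)

    record IsMinimalComplete (Γ : Problem) (S : Pred Substitution 0ℓ) : Set where
      field
        sound    : S ⊆ Unifier Γ
        complete : ∀ θ → Unifier Γ θ → ∃ λ σ → S σ × σ ≤ⱽ θ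
        minimal  : ∀ σ τ → S σ → S τ → ¬ (σ ≗ˢ τ) → ¬ (σ ≤ⱽ τ)

    ProblemHasType : Problem → UnificationType → Set₁
    ProblemHasType Γ unitary    =
      ∃ λ S → IsMinimalComplete Γ S × HasCardinality S 1
    ProblemHasType Γ finitary   =
      ∃ λ S → IsMinimalComplete Γ S × ∃ λ k → 1 ℕ.< k × HasCardinality S k
    ProblemHasType Γ infinitary =
      ∃ λ S → IsMinimalComplete Γ S × Infinite S
    ProblemHasType Γ zero       =
      ¬ ∃ λ S → IsMinimalComplete Γ S

    -- The type of E is the largest type of a solvable problem: it is attained,
    -- and it bounds the type of every solvable problem.
    record TheoryHasType (t : UnificationType) : Set₁ where
      field
        attained : ∃ λ Γ → Solvable Γ × ProblemHasType Γ t
        bound    : ∀ Γ → Solvable Γ → ∀ u → ProblemHasType Γ u → u ≤ᵗ t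

{-# OPTIONS --safe #-}

-- No problem has type zero.  Let τ be a unifier of Γ that is the identity from
-- k on, with variables below k and role depth at most k, and let ρ map σ to τ.
-- For v ≥ k, ρ sends some variable y_v of σ(v) to v; the y_v are distinct, and
-- none occurs in σ(0), …, σ(k − 1), because equivalent terms have the same
-- variables.  Hence at most k variables occur there.  Renaming these into
-- [0, k) and resetting σ to the identity from k on gives a unifier below σ
-- which obeys the same bounds as τ, and up to equivalence there are only
-- finitely many of those.  So every unifier has a minimal unifier below it; as
-- the instantiation preorder is decidable, the first member of each minimal
-- class in a fixed enumeration can be computed.
--
-- If σ unifies ∃r.y ⊓ x ≈ ∃r.y, then no conjunct of σ(x) is a variable.  If
-- moreover σ is below x ↦ ⨅_{j<m} ∃r.z_j, y ↦ ⨅_{j<m} z_j, then each z_j is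
-- the image of a variable of σ(x), so σ(x) has at least m variables.  Hence no
-- finite set of unifiers is complete.
module Submission where

open import Defs
open import Data.Bool.Base using (if_then_else_)
open import Data.Fin.Base as Fin using (Fin; toℕ; fromℕ<)
import Data.Fin.Properties as Fin
open import Data.List.Base
  using (List; []; _∷_; _++_; length; lookup; map; concatMap; cartesianProductWith; upTo; allFin;
         deduplicate; filter)
open import Data.List.Extrema.Nat using (max; xs≤max)
open import Data.List.Membership.Propositional using (_∈_; _∉_; find; lose)
open import Data.List.Membership.Propositional.Properties
open import Data.List.Membership.DecPropositional using () renaming (_∈?_ to mem?)
open import Data.List.Properties using (length-++; length-map; length-upTo)
open import Data.List.Relation.Unary.All as All using (All; []; _∷_)
import Data.List.Relation.Unary.All.Properties as All
open import Data.List.Relation.Unary.AllPairs.Core using ([]; _∷_)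
open import Data.List.Relation.Unary.Any as Any using (Any; here; there)
import Data.List.Relation.Unary.Any.Properties as Any
import Data.List.Relation.Unary.Unique.Propositional as Propositional
open import Data.List.Relation.Unary.Unique.DecPropositional.Properties using (deduplicate-!)
import Data.List.Relation.Unary.Unique.Propositional.Properties as Unique
open import Data.Nat.Base
  using (ℕ; zero; suc; NonZero; _+_; _⊔_; _≤_; _<_; z≤n; s≤s; z<s)
open import Data.Nat.Properties
  using (_≟_; _<?_; ≤-refl; ≤-trans; ≤-reflexive; <-≤-trans; <⇒≱; <-irrefl;
         ≮⇒≥; n<1+n; n≤1+n; m≤m+n; m≤n+m; m≤m⊔n; m≤n⊔m; +-cancelˡ-≤; +-cancelʳ-≡; +-monoˡ-<;
         allUpTo?; <-cmp; m<1+n⇒m<n∨m≡n)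
open import Data.Product.Base using (∃; _×_; _,_; proj₁; proj₂; uncurry)
open import Data.Sum.Base using (_⊎_; inj₁; inj₂; [_,_]′)
open import Function.Base using (_∘_; id; case_of_)
open import Level using (0ℓ)
open import Relation.Binary.Bundles using (Setoid)
open import Relation.Binary.Core using (Rel)
open import Relation.Binary.Definitions using (Decidable; tri<; tri≈; tri>)
open import Relation.Binary.PropositionalEquality as ≡ using (_≡_; _≢_; refl)
import Relation.Binary.Reasoning.Setoid as SetoidReasoning
open import Relation.Nullary.Decidable
  using (Dec; yes; no; does; dec-true; dec-false; map′; _×-dec_; _⊎-dec_)
open import Relation.Nullary.Negation using (¬_; contradiction)
open import Relation.Unary as Unary using (Pred; _⊆_)

-- Lists, pigeonhole counting, least numbers and minimal elements.

module _ {A : Set} where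

  lookup-injective : {xs : List A} → Propositional.Unique xs →
                     ∀ i j → lookup xs i ≡ lookup xs j → i ≡ j
  lookup-injective (_  ∷ _)  Fin.zero    Fin.zero    _  = refl
  lookup-injective (x≢ ∷ _)  Fin.zero    (Fin.suc j) eq =
    contradiction eq (All.lookup x≢ (∈-lookup j))
  lookup-injective (x≢ ∷ _)  (Fin.suc i) Fin.zero    eq =
    contradiction (≡.sym eq) (All.lookup x≢ (∈-lookup i))
  lookup-injective (_  ∷ xs) (Fin.suc i) (Fin.suc j) eq =
    ≡.cong Fin.suc (lookup-injective xs i j eq)

  maximum : (A → ℕ) → List A → ℕ
  maximum f xs = max 0 (map f xs)

  ≤-maximum : (f : A → ℕ) {x : A} {xs : List A} → x ∈ xs → f x ≤ maximum f xs
  ≤-maximum f {xs = xs} x∈xs = All.lookup (xs≤max 0 (map f xs)) (∈-map⁺ f x∈xs)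

  -- Recording that `P` fails on all earlier entries makes the witness unique, so that it can serve
  -- as a chosen representative.
  data IsFirst (P : Pred A 0ℓ) (x : A) : List A → Set where
    here  : ∀ {xs} → P x → IsFirst P x (x ∷ xs)
    there : ∀ {y xs} → ¬ P y → IsFirst P x xs → IsFirst P x (y ∷ xs)

  first : {P : Pred A 0ℓ} → Unary.Decidable P → ∀ {xs} → Any P xs → ∃ λ x → IsFirst P x xs
  first P? {x ∷ xs} any with P? x
  ... | yes px = x , here px
  ... | no ¬px = let y , isFirst = first P? (Any.tail ¬px any) in y , there ¬px isFirst

  first-satisfies : ∀ {P : Pred A 0ℓ} {x xs} → IsFirst P x xs → P x
  first-satisfies (here px)   = px
  first-satisfies (there _ i) = first-satisfies i

  first-map : ∀ {P Q : Pred A 0ℓ} → P ⊆ Q → Q ⊆ P → ∀ {x xs} → IsFirst P x xs → IsFirst Q x xs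
  first-map P⊆Q Q⊆P (here px)     = here (P⊆Q px)
  first-map P⊆Q Q⊆P (there ¬py i) = there (¬py ∘ Q⊆P) (first-map P⊆Q Q⊆P i)

  first-∈ : ∀ {P : Pred A 0ℓ} {x xs} → IsFirst P x xs → x ∈ xs
  first-∈ (here _)    = here refl
  first-∈ (there _ i) = there (first-∈ i)

  first-unique : ∀ {P : Pred A 0ℓ} {x y xs} → IsFirst P x xs → IsFirst P y xs → x ≡ y
  first-unique (here _)    (here _)    = refl
  first-unique (here px)   (there ¬px _) = contradiction px ¬px
  first-unique (there ¬px _) (here px)   = contradiction px ¬px
  first-unique (there _ i) (there _ j) = first-unique i j

-- Pigeonhole: without repetitions, the positions of the list inject into `Fin m`.
unique-length-≤ : ∀ {m xs} → Propositional.Unique xs → All (_< m) xs → length xs ≤ m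
unique-length-≤ {m} {xs} unique bounded = Fin.injective⇒≤ {f = f} λ {i} {j} eq →
  lookup-injective unique i j (Fin.fromℕ<-injective _ _ (below i) (below j) eq)
  where
  below : ∀ i → lookup xs i < m
  below i = All.lookup bounded (∈-lookup i)
  f : Fin (length xs) → Fin m
  f i = fromℕ< (below i)

least : {P : Pred ℕ 0ℓ} → Unary.Decidable P → ∀ {m} → P m →
        ∃ λ k → P k × (∀ {j} → j < k → ¬ P j)
least {P} P? {m} pm = [ id , (λ none → m , pm , none) ]′ (search m)
  where
  search : ∀ m → (∃ λ k → P k × (∀ {j} → j < k → ¬ P j)) ⊎ (∀ {j} → j < m → ¬ P j)
  search zero    = inj₂ λ ()
  search (suc m) with search m | P? m
  ... | inj₁ found | _      = inj₁ found
  ... | inj₂ none  | yes pm = inj₁ (m , pm , none)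
  ... | inj₂ none  | no ¬pm = inj₂ λ j<1+m pj →
    [ (λ j<m → none j<m pj) , (λ j≡m → ¬pm (≡.subst P j≡m pj)) ]′ (m<1+n⇒m<n∨m≡n j<1+m)

module _ {A : Set} {_≲_ : Rel A 0ℓ} (≲-refl : ∀ {x} → x ≲ x)
         (≲-trans : ∀ {x y z} → x ≲ y → y ≲ z → x ≲ z) (_≲?_ : Decidable _≲_) {P : Pred A 0ℓ} where

  -- The list is processed from its end, keeping a current element; it is replaced only by an entry
  -- strictly below it. The starting point `a` need not be listed.
  minimal-below : ∀ xs → All P xs → ∀ {a} → P a →
                  ∃ λ m → P m × m ≲ a × (∀ {x} → x ∈ xs → x ≲ m → m ≲ x)
  minimal-below []       []         {a} pa = a , pa , ≲-refl , λ ()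
  minimal-below (x ∷ xs) (px ∷ pxs) {a} pa with minimal-below xs pxs pa
  ... | m , pm , m≲a , min with x ≲? m | m ≲? x
  ... | no  x⋦m | _       = m , pm , m≲a , λ where
        (here refl) x≲m → contradiction x≲m x⋦m
        (there y∈)      → min y∈
  ... | yes _   | yes m≲x = m , pm , m≲a , λ where
        (here refl) _ → m≲x
        (there y∈)    → min y∈
  -- An earlier entry below `x` is also below `m`, hence above `m` by minimality, hence above `x`.
  ... | yes x≲m | no  _   = x , px , ≲-trans x≲m m≲a , λ where
        (here refl) _   → ≲-refl
        (there y∈)  y≲x → ≲-trans x≲m (min y∈ (≲-trans y≲x x≲m))

module _ (n : ℕ) where

  open Unification n

  infix 4 _≈_
  _≈_ : Rel Term 0ℓ
  _≈_ = EL ⊢_≈_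

  termSetoid : Setoid 0ℓ 0ℓ
  termSetoid = record { Carrier = Term ; _≈_ = _≈_
                      ; isEquivalence = record { refl = refl ; sym = sym ; trans = trans } }

  open SetoidReasoning termSetoid

  reflexive : ∀ {s t} → s ≡ t → s ≈ t
  reflexive = Setoid.reflexive termSetoid

  -- Cut-free subsumption

  infix 4 _⊑_
  data _⊑_ : Rel Term 0ℓ where
    ⊤ʳ   : ∀ {s} → s ⊑ ⊤
    ⊓ʳ   : ∀ {s t u} → s ⊑ t → s ⊑ u → s ⊑ t ⊓ u
    varᵐ : ∀ {v} → var v ⊑ var v
    ∃ᵐ   : ∀ {r s t} → s ⊑ t → ∃⟨ r ⟩ s ⊑ ∃⟨ r ⟩ t
    ⊓ˡ₁  : ∀ {s t u} → s ⊑ u → s ⊓ t ⊑ u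
    ⊓ˡ₂  : ∀ {s t u} → t ⊑ u → s ⊓ t ⊑ u

  ⊑-refl : ∀ {t} → t ⊑ t
  ⊑-refl {var _}    = varᵐ
  ⊑-refl {⊤}        = ⊤ʳ
  ⊑-refl {_ ⊓ _}    = ⊓ʳ (⊓ˡ₁ ⊑-refl) (⊓ˡ₂ ⊑-refl)
  ⊑-refl {∃⟨ _ ⟩ _} = ∃ᵐ ⊑-refl

  -- Cut elimination: the cut moves into the premises until a right rule meets the matching left
  -- rule. In each call one derivation shrinks and the other does not grow.
  ⊑-trans : ∀ {s t u} → s ⊑ t → t ⊑ u → s ⊑ u
  ⊑-trans _        ⊤ʳ        = ⊤ʳ
  ⊑-trans p        (⊓ʳ q q′) = ⊓ʳ (⊑-trans p q) (⊑-trans p q′)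
  ⊑-trans (⊓ˡ₁ p)  q         = ⊓ˡ₁ (⊑-trans p q)
  ⊑-trans (⊓ˡ₂ p)  q         = ⊓ˡ₂ (⊑-trans p q)
  ⊑-trans varᵐ     varᵐ      = varᵐ
  ⊑-trans (∃ᵐ p)   (∃ᵐ q)    = ∃ᵐ (⊑-trans p q)
  ⊑-trans (⊓ʳ p _) (⊓ˡ₁ q)   = ⊑-trans p q
  ⊑-trans (⊓ʳ _ p) (⊓ˡ₂ q)   = ⊑-trans p q

  ⊑-⊓⁻ : ∀ {s t u} → s ⊑ t ⊓ u → s ⊑ t × s ⊑ u
  ⊑-⊓⁻ p = ⊑-trans p (⊓ˡ₁ ⊑-refl) , ⊑-trans p (⊓ˡ₂ ⊑-refl)

  ⊓-⊑-var⁻ : ∀ {s t v} → s ⊓ t ⊑ var v → s ⊑ var v ⊎ t ⊑ var v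
  ⊓-⊑-var⁻ (⊓ˡ₁ p) = inj₁ p
  ⊓-⊑-var⁻ (⊓ˡ₂ p) = inj₂ p

  ⊓-⊑-∃⁻ : ∀ {s t r u} → s ⊓ t ⊑ ∃⟨ r ⟩ u → s ⊑ ∃⟨ r ⟩ u ⊎ t ⊑ ∃⟨ r ⟩ u
  ⊓-⊑-∃⁻ (⊓ˡ₁ p) = inj₁ p
  ⊓-⊑-∃⁻ (⊓ˡ₂ p) = inj₂ p

  infix 4 _⊑?_
  -- Decomposing a conjunction on the right first loses nothing. Against a variable or an
  -- existential restriction, a conjunction on the left must contribute one of its two sides.
  _⊑?_ : Decidable _⊑_
  s          ⊑? ⊤          = yes ⊤ʳ
  s          ⊑? t ⊓ u      = map′ (uncurry ⊓ʳ) ⊑-⊓⁻ (s ⊑? t ×-dec s ⊑? u)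
  var v      ⊑? var w      = map′ (λ { refl → varᵐ }) (λ { varᵐ → refl }) (v ≟ w)
  ⊤          ⊑? var w      = no λ ()
  s ⊓ t      ⊑? var w      = map′ [ ⊓ˡ₁ , ⊓ˡ₂ ]′ ⊓-⊑-var⁻ (s ⊑? var w ⊎-dec t ⊑? var w)
  ∃⟨ r ⟩ s   ⊑? var w      = no λ ()
  var v      ⊑? ∃⟨ r ⟩ u   = no λ ()
  ⊤          ⊑? ∃⟨ r ⟩ u   = no λ ()
  s ⊓ t      ⊑? ∃⟨ r ⟩ u   = map′ [ ⊓ˡ₁ , ⊓ˡ₂ ]′ ⊓-⊑-∃⁻ (s ⊑? ∃⟨ r ⟩ u ⊎-dec t ⊑? ∃⟨ r ⟩ u)
  ∃⟨ r ⟩ s   ⊑? ∃⟨ r′ ⟩ u  =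
    map′ (λ { (refl , p) → ∃ᵐ p }) (λ { (∃ᵐ p) → refl , p }) (r Fin.≟ r′ ×-dec s ⊑? u)

  -- Subsumption as the semilattice order of the equational theory.

  private
    -- Values for the variables 0, 1 and 2, in which the identities of `EL` are written.
    instantiate : Term → Term → Term → Var → Term
    instantiate s t u 0 = s
    instantiate s t u 1 = t
    instantiate s t u _ = u

  ⊓-comm : ∀ s t → s ⊓ t ≈ t ⊓ s
  ⊓-comm s t = axiom (instantiate s t ⊤) comm

  ⊓-assoc : ∀ s t u → (s ⊓ t) ⊓ u ≈ s ⊓ (t ⊓ u)
  ⊓-assoc s t u = axiom (instantiate s t u) assoc

  ⊓-idem : ∀ s → s ⊓ s ≈ s
  ⊓-idem s = axiom (instantiate s ⊤ ⊤) idem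

  ⊓-identityʳ : ∀ s → s ⊓ ⊤ ≈ s
  ⊓-identityʳ s = axiom (instantiate s ⊤ ⊤) unit

  ∃-mono : ∀ r s t → ∃⟨ r ⟩ s ⊓ ∃⟨ r ⟩ (s ⊓ t) ≈ ∃⟨ r ⟩ (s ⊓ t)
  ∃-mono r s t = axiom (instantiate s t ⊤) (mono r)

  ⊑⇒⊓≈ : ∀ {s t} → s ⊑ t → s ⊓ t ≈ s
  ⊑⇒⊓≈ {s} ⊤ʳ = ⊓-identityʳ s
  ⊑⇒⊓≈ {s} (⊓ʳ {t = t} {u} p q) = begin
    s ⊓ (t ⊓ u)  ≈⟨ ⊓-assoc s t u ⟨
    (s ⊓ t) ⊓ u  ≈⟨ ⊓-cong (⊑⇒⊓≈ p) refl ⟩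
    s ⊓ u        ≈⟨ ⊑⇒⊓≈ q ⟩
    s            ∎
  ⊑⇒⊓≈ varᵐ = ⊓-idem _
  ⊑⇒⊓≈ (∃ᵐ {r} {s} {t} p) = begin
    ∃⟨ r ⟩ s ⊓ ∃⟨ r ⟩ t        ≈⟨ ⊓-comm _ _ ⟩
    -- Writing `s` as `t ⊓ s` produces an instance of the monotonicity identity.
    ∃⟨ r ⟩ t ⊓ ∃⟨ r ⟩ s        ≈⟨ ⊓-cong refl (∃-cong t⊓s≈s) ⟨
    ∃⟨ r ⟩ t ⊓ ∃⟨ r ⟩ (t ⊓ s)  ≈⟨ ∃-mono r t s ⟩
    ∃⟨ r ⟩ (t ⊓ s)             ≈⟨ ∃-cong t⊓s≈s ⟩
    ∃⟨ r ⟩ s                   ∎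
    where
    t⊓s≈s : t ⊓ s ≈ s
    t⊓s≈s = trans (⊓-comm t s) (⊑⇒⊓≈ p)
  ⊑⇒⊓≈ (⊓ˡ₁ {s} {t} {u} p) = begin
    (s ⊓ t) ⊓ u  ≈⟨ ⊓-cong (⊓-comm s t) refl ⟩
    (t ⊓ s) ⊓ u  ≈⟨ ⊓-assoc t s u ⟩
    t ⊓ (s ⊓ u)  ≈⟨ ⊓-cong refl (⊑⇒⊓≈ p) ⟩
    t ⊓ s        ≈⟨ ⊓-comm t s ⟩
    s ⊓ t        ∎
  ⊑⇒⊓≈ (⊓ˡ₂ {s} {t} {u} p) = begin
    (s ⊓ t) ⊓ u  ≈⟨ ⊓-assoc s t u ⟩
    s ⊓ (t ⊓ u)  ≈⟨ ⊓-cong refl (⊑⇒⊓≈ p) ⟩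
    s ⊓ t        ∎

  ⊑-antisym : ∀ {s t} → s ⊑ t → t ⊑ s → s ≈ t
  ⊑-antisym {s} {t} p q = begin
    s      ≈⟨ ⊑⇒⊓≈ p ⟨
    s ⊓ t  ≈⟨ ⊓-comm s t ⟩
    t ⊓ s  ≈⟨ ⊑⇒⊓≈ q ⟩
    t      ∎

  -- Induction on the equational derivation. Both directions are carried along because `sym`
  -- exchanges them; `trans` is where admissibility of cut enters.
  ≈⇒⊑⊒ : ∀ {s t} → s ≈ t → s ⊑ t × t ⊑ s
  ≈⇒⊑⊒ (axiom f comm)     = ⊓ʳ (⊓ˡ₂ ⊑-refl) (⊓ˡ₁ ⊑-refl) , ⊓ʳ (⊓ˡ₂ ⊑-refl) (⊓ˡ₁ ⊑-refl)
  ≈⇒⊑⊒ (axiom f assoc)    =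
    ⊓ʳ (⊓ˡ₁ (⊓ˡ₁ ⊑-refl)) (⊓ʳ (⊓ˡ₁ (⊓ˡ₂ ⊑-refl)) (⊓ˡ₂ ⊑-refl)) ,
    ⊓ʳ (⊓ʳ (⊓ˡ₁ ⊑-refl) (⊓ˡ₂ (⊓ˡ₁ ⊑-refl))) (⊓ˡ₂ (⊓ˡ₂ ⊑-refl))
  ≈⇒⊑⊒ (axiom f idem)     = ⊓ˡ₁ ⊑-refl , ⊓ʳ ⊑-refl ⊑-refl
  ≈⇒⊑⊒ (axiom f unit)     = ⊓ˡ₁ ⊑-refl , ⊓ʳ ⊑-refl ⊤ʳ
  ≈⇒⊑⊒ (axiom f (mono r)) = ⊓ˡ₂ ⊑-refl , ⊓ʳ (∃ᵐ (⊓ˡ₁ ⊑-refl)) ⊑-refl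
  ≈⇒⊑⊒ refl               = ⊑-refl , ⊑-refl
  ≈⇒⊑⊒ (sym p)            = let a , b = ≈⇒⊑⊒ p in b , a
  ≈⇒⊑⊒ (trans p q)        =
    let a , b = ≈⇒⊑⊒ p
        c , d = ≈⇒⊑⊒ q
    in ⊑-trans a c , ⊑-trans d b
  ≈⇒⊑⊒ (⊓-cong p q)       =
    let a , b = ≈⇒⊑⊒ p
        c , d = ≈⇒⊑⊒ q
    in ⊓ʳ (⊓ˡ₁ a) (⊓ˡ₂ c) , ⊓ʳ (⊓ˡ₁ b) (⊓ˡ₂ d)
  ≈⇒⊑⊒ (∃-cong p)         = let a , b = ≈⇒⊑⊒ p in ∃ᵐ a , ∃ᵐ b

  ≈⇒⊑ : ∀ {s t} → s ≈ t → s ⊑ t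
  ≈⇒⊑ = proj₁ ∘ ≈⇒⊑⊒

  ≈⇒⊒ : ∀ {s t} → s ≈ t → t ⊑ s
  ≈⇒⊒ = proj₂ ∘ ≈⇒⊑⊒

  infix 4 _≈?_
  _≈?_ : Decidable _≈_
  s ≈? t = map′ (uncurry ⊑-antisym) ≈⇒⊑⊒ (s ⊑? t ×-dec t ⊑? s)

  -- Variables of terms and application of assignments.

  vars : Term → List Var
  vars (var v)    = v ∷ []
  vars ⊤          = []
  vars (s ⊓ t)    = vars s ++ vars t
  vars (∃⟨ _ ⟩ t) = vars t

  extend-∘ : ∀ (g f : Var → Term) t → extend g (extend f t) ≡ extend (extend g ∘ f) t
  extend-∘ g f (var _)    = refl
  extend-∘ g f ⊤          = refl
  extend-∘ g f (s ⊓ t)    = ≡.cong₂ _⊓_ (extend-∘ g f s) (extend-∘ g f t)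
  extend-∘ g f (∃⟨ r ⟩ t) = ≡.cong ∃⟨ r ⟩_ (extend-∘ g f t)

  extend-var : ∀ t → extend var t ≡ t
  extend-var (var _)    = refl
  extend-var ⊤          = refl
  extend-var (s ⊓ t)    = ≡.cong₂ _⊓_ (extend-var s) (extend-var t)
  extend-var (∃⟨ r ⟩ t) = ≡.cong ∃⟨ r ⟩_ (extend-var t)

  extend-cong : ∀ {f g : Var → Term} t → (∀ {v} → v ∈ vars t → f v ≈ g v) → extend f t ≈ extend g t
  extend-cong (var _)    f≈g = f≈g (here refl)
  extend-cong ⊤          f≈g = refl
  extend-cong (s ⊓ t)    f≈g =
    ⊓-cong (extend-cong s (f≈g ∘ ∈-++⁺ˡ)) (extend-cong t (f≈g ∘ ∈-++⁺ʳ (vars s)))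
  extend-cong (∃⟨ r ⟩ t) f≈g = ∃-cong (extend-cong t f≈g)

  extend-mono-⊑ : ∀ (f : Var → Term) {s t} → s ⊑ t → extend f s ⊑ extend f t
  extend-mono-⊑ f ⊤ʳ       = ⊤ʳ
  extend-mono-⊑ f (⊓ʳ p q) = ⊓ʳ (extend-mono-⊑ f p) (extend-mono-⊑ f q)
  extend-mono-⊑ f varᵐ     = ⊑-refl
  extend-mono-⊑ f (∃ᵐ p)   = ∃ᵐ (extend-mono-⊑ f p)
  extend-mono-⊑ f (⊓ˡ₁ p)  = ⊓ˡ₁ (extend-mono-⊑ f p)
  extend-mono-⊑ f (⊓ˡ₂ p)  = ⊓ˡ₂ (extend-mono-⊑ f p)

  extend-resp-≈ : ∀ (f : Var → Term) {s t} → s ≈ t → extend f s ≈ extend f t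
  extend-resp-≈ f p = ⊑-antisym (extend-mono-⊑ f (≈⇒⊑ p)) (extend-mono-⊑ f (≈⇒⊒ p))

  -- Subsumption by `var v` selects one conjunct of `t`, and the converse subsumption restricts to
  -- that conjunct. Only a variable of `t` can satisfy both.
  var-preimage : ∀ {f : Var → Term} {v} t → extend f t ≈ var v → ∃ λ w → w ∈ vars t × f w ≈ var v
  var-preimage {f} {v} t p = go t (≈⇒⊑ p) (≈⇒⊒ p)
    where
    go : ∀ t → extend f t ⊑ var v → var v ⊑ extend f t → ∃ λ w → w ∈ vars t × f w ≈ var v
    go (var w) p q = w , here refl , ⊑-antisym p q
    go (s ⊓ t) p q with ⊓-⊑-var⁻ p
    ... | inj₁ p′ = let w , w∈ , eq = go s p′ (proj₁ (⊑-⊓⁻ q)) in w , ∈-++⁺ˡ w∈ , eq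
    ... | inj₂ p′ = let w , w∈ , eq = go t p′ (proj₂ (⊑-⊓⁻ q)) in w , ∈-++⁺ʳ (vars s) w∈ , eq

  var-injective : ∀ {v w} → var v ≈ var w → v ≡ w
  var-injective p with varᵐ ← ≈⇒⊑ p = refl

  -- Terms and substitutions of bounded size

  data Bounded (k : ℕ) : ℕ → Pred Term 0ℓ where
    varᵇ : ∀ {d v} → v < k → Bounded k d (var v)
    ⊤ᵇ   : ∀ {d} → Bounded k d ⊤
    ⊓ᵇ   : ∀ {d s t} → Bounded k d s → Bounded k d t → Bounded k d (s ⊓ t)
    ∃ᵇ   : ∀ {d r t} → Bounded k d t → Bounded k (suc d) (∃⟨ r ⟩ t)

  bounded? : ∀ k d → Unary.Decidable (Bounded k d)
  bounded? k d       (var v)    = map′ varᵇ (λ { (varᵇ p) → p }) (v <? k)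
  bounded? k d       ⊤          = yes ⊤ᵇ
  bounded? k d       (s ⊓ t)    =
    map′ (uncurry ⊓ᵇ) (λ { (⊓ᵇ p q) → p , q }) (bounded? k d s ×-dec bounded? k d t)
  bounded? k zero    (∃⟨ r ⟩ t) = no λ ()
  bounded? k (suc d) (∃⟨ r ⟩ t) = map′ ∃ᵇ (λ { (∃ᵇ p) → p }) (bounded? k d t)

  Bounded-mono : ∀ {k k′ d d′} → k ≤ k′ → d ≤ d′ → ∀ {t} → Bounded k d t → Bounded k′ d′ t
  Bounded-mono k≤ d≤       (varᵇ v<k) = varᵇ (<-≤-trans v<k k≤)
  Bounded-mono k≤ d≤       ⊤ᵇ         = ⊤ᵇ
  Bounded-mono k≤ d≤       (⊓ᵇ p q)   = ⊓ᵇ (Bounded-mono k≤ d≤ p) (Bounded-mono k≤ d≤ q)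
  Bounded-mono k≤ (s≤s d≤) (∃ᵇ p)     = ∃ᵇ (Bounded-mono k≤ d≤ p)

  bound : Term → ℕ
  bound (var v)    = suc v
  bound ⊤          = 0
  bound (s ⊓ t)    = bound s ⊔ bound t
  bound (∃⟨ _ ⟩ t) = suc (bound t)

  bounded : ∀ t → Bounded (bound t) (bound t) t
  bounded (var v)    = varᵇ ≤-refl
  bounded ⊤          = ⊤ᵇ
  bounded (s ⊓ t)    = ⊓ᵇ (Bounded-mono s≤ s≤ (bounded s)) (Bounded-mono t≤ t≤ (bounded t))
    where
    s≤ = m≤m⊔n (bound s) (bound t)
    t≤ = m≤n⊔m (bound s) (bound t)
  bounded (∃⟨ _ ⟩ t) = ∃ᵇ (Bounded-mono (n≤1+n _) ≤-refl (bounded t))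

  -- In a derivation every variable and every role on the right is matched with one on the left, so
  -- the right side gains neither variables nor depth.
  Bounded-resp-⊑ : ∀ {k d s t} → s ⊑ t → Bounded k d s → Bounded k d t
  Bounded-resp-⊑ ⊤ʳ        _        = ⊤ᵇ
  Bounded-resp-⊑ (⊓ʳ p p′) b        = ⊓ᵇ (Bounded-resp-⊑ p b) (Bounded-resp-⊑ p′ b)
  Bounded-resp-⊑ varᵐ      b        = b
  Bounded-resp-⊑ (∃ᵐ p)    (∃ᵇ b)   = ∃ᵇ (Bounded-resp-⊑ p b)
  Bounded-resp-⊑ (⊓ˡ₁ p)   (⊓ᵇ b _) = Bounded-resp-⊑ p b
  Bounded-resp-⊑ (⊓ˡ₂ p)   (⊓ᵇ _ b) = Bounded-resp-⊑ p b

  Bounded-vars : ∀ {k d v} t → Bounded k d t → v ∈ vars t → v < k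
  Bounded-vars (var _)    (varᵇ v<k) (here refl) = v<k
  Bounded-vars (s ⊓ t)    (⊓ᵇ p q)   v∈          =
    [ Bounded-vars s p , Bounded-vars t q ]′ (∈-++⁻ (vars s) v∈)
  Bounded-vars (∃⟨ _ ⟩ t) (∃ᵇ p)     v∈          = Bounded-vars t p v∈

  Bounded-extend⁻ : ∀ {k d v} {f : Var → Term} t →
                    Bounded k d (extend f t) → v ∈ vars t → Bounded k d (f v)
  Bounded-extend⁻ (var _)    p        (here refl) = p
  Bounded-extend⁻ (s ⊓ t)    (⊓ᵇ p q) v∈          =
    [ Bounded-extend⁻ s p , Bounded-extend⁻ t q ]′ (∈-++⁻ (vars s) v∈)
  Bounded-extend⁻ (∃⟨ _ ⟩ t) (∃ᵇ p)   v∈          =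
    Bounded-mono ≤-refl (n≤1+n _) (Bounded-extend⁻ t p v∈)

  -- The bound on `extend f t` also bounds the role depth of `t`, which a renaming leaves unchanged.
  Bounded-rename : ∀ {k d} {f : Var → Term} {g : Var → Var} t → Bounded k d (extend f t) →
                   (∀ {v} → v ∈ vars t → g v < k) → Bounded k d (extend (var ∘ g) t)
  Bounded-rename (var _)    _        g< = varᵇ (g< (here refl))
  Bounded-rename ⊤          _        g< = ⊤ᵇ
  Bounded-rename (s ⊓ t)    (⊓ᵇ p q) g< =
    ⊓ᵇ (Bounded-rename s p (g< ∘ ∈-++⁺ˡ)) (Bounded-rename t q (g< ∘ ∈-++⁺ʳ (vars s)))
  Bounded-rename (∃⟨ _ ⟩ t) (∃ᵇ p)   g< = ∃ᵇ (Bounded-rename t p g<)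

  -- Finite enumerations of bounded terms and assignments up to equivalence.

  -- One conjunction per sublist, ended by `⊤`. Modulo associativity, commutativity, idempotence and
  -- unit, this covers all conjunctions of members of the list.
  conjunctions : List Term → List Term
  conjunctions []       = ⊤ ∷ []
  conjunctions (a ∷ as) = conjunctions as ++ map (a ⊓_) (conjunctions as)

  conjunctions-⊤ : ∀ as → ⊤ ∈ conjunctions as
  conjunctions-⊤ []       = here refl
  conjunctions-⊤ (a ∷ as) = ∈-++⁺ˡ (conjunctions-⊤ as)

  conjunctions-atom : ∀ {a as} → a ∈ as → Any (a ≈_) (conjunctions as)
  conjunctions-atom {a} {_ ∷ as} (here refl) =
    Any.++⁺ʳ (conjunctions as) (Any.map⁺ (lose (conjunctions-⊤ as) (sym (⊓-identityʳ a))))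
  conjunctions-atom (there a∈as) = Any.++⁺ˡ (conjunctions-atom a∈as)

  -- This is the union of two sublists: `a` is kept if either side has it, commutativity moves it to
  -- the front, and idempotence merges two copies.
  conjunctions-⊓ : ∀ as {s t} → s ∈ conjunctions as → t ∈ conjunctions as →
                   Any (s ⊓ t ≈_) (conjunctions as)
  conjunctions-⊓ []       (here refl) (here refl) = here (⊓-idem ⊤)
  conjunctions-⊓ (a ∷ as) {s} {t} s∈ t∈
    with ∈-++⁻ (conjunctions as) s∈ | ∈-++⁻ (conjunctions as) t∈
  ... | inj₁ s∈ | inj₁ t∈ = Any.++⁺ˡ (conjunctions-⊓ as s∈ t∈)
  ... | inj₁ s∈ | inj₂ t∈ with t′ , t′∈ , refl ← ∈-map⁻ (a ⊓_) t∈ =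
    Any.++⁺ʳ (conjunctions as) (Any.map⁺ (Any.map step (conjunctions-⊓ as s∈ t′∈)))
    where
    step : ∀ {u} → s ⊓ t′ ≈ u → s ⊓ (a ⊓ t′) ≈ a ⊓ u
    step {u} p = begin
      s ⊓ (a ⊓ t′)  ≈⟨ ⊓-assoc s a t′ ⟨
      (s ⊓ a) ⊓ t′  ≈⟨ ⊓-cong (⊓-comm s a) refl ⟩
      (a ⊓ s) ⊓ t′  ≈⟨ ⊓-assoc a s t′ ⟩
      a ⊓ (s ⊓ t′)  ≈⟨ ⊓-cong refl p ⟩
      a ⊓ u         ∎
  ... | inj₂ s∈ | inj₁ t∈ with s′ , s′∈ , refl ← ∈-map⁻ (a ⊓_) s∈ =
    Any.++⁺ʳ (conjunctions as) (Any.map⁺ (Any.map step (conjunctions-⊓ as s′∈ t∈)))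
    where
    step : ∀ {u} → s′ ⊓ t ≈ u → (a ⊓ s′) ⊓ t ≈ a ⊓ u
    step p = trans (⊓-assoc a s′ t) (⊓-cong refl p)
  ... | inj₂ s∈ | inj₂ t∈
    with s′ , s′∈ , refl ← ∈-map⁻ (a ⊓_) s∈ | t′ , t′∈ , refl ← ∈-map⁻ (a ⊓_) t∈ =
    Any.++⁺ʳ (conjunctions as) (Any.map⁺ (Any.map step (conjunctions-⊓ as s′∈ t′∈)))
    where
    step : ∀ {u} → s′ ⊓ t′ ≈ u → (a ⊓ s′) ⊓ (a ⊓ t′) ≈ a ⊓ u
    step p = trans
      (⊑-antisym
        (⊓ʳ (⊓ˡ₁ (⊓ˡ₁ ⊑-refl)) (⊓ʳ (⊓ˡ₁ (⊓ˡ₂ ⊑-refl)) (⊓ˡ₂ (⊓ˡ₂ ⊑-refl))))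
        (⊓ʳ (⊓ʳ (⊓ˡ₁ ⊑-refl) (⊓ˡ₂ (⊓ˡ₁ ⊑-refl))) (⊓ʳ (⊓ˡ₁ ⊑-refl) (⊓ˡ₂ (⊓ˡ₂ ⊑-refl)))))
      (⊓-cong refl p)

  mutual
    atoms : ℕ → ℕ → List Term
    atoms k zero    = map var (upTo k)
    atoms k (suc d) = map var (upTo k) ++ cartesianProductWith ∃⟨_⟩_ (allFin n) (terms k d)

    terms : ℕ → ℕ → List Term
    terms k d = conjunctions (atoms k d)

  var∈atoms : ∀ {k v} d → v < k → var v ∈ atoms k d
  var∈atoms zero    v<k = ∈-map⁺ var (∈-upTo⁺ v<k)
  var∈atoms (suc d) v<k = ∈-++⁺ˡ (∈-map⁺ var (∈-upTo⁺ v<k))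

  terms-complete : ∀ {k d t} → Bounded k d t → Any (t ≈_) (terms k d)
  terms-complete {d = d} (varᵇ v<k) = conjunctions-atom (var∈atoms d v<k)
  terms-complete {k} {d} ⊤ᵇ = lose (conjunctions-⊤ (atoms k d)) refl
  terms-complete {k} {d} (⊓ᵇ p q) =
    let s′ , s′∈ , s≈s′ = find (terms-complete p)
        t′ , t′∈ , t≈t′ = find (terms-complete q)
    in Any.map (trans (⊓-cong s≈s′ t≈t′)) (conjunctions-⊓ (atoms k d) s′∈ t′∈)
  terms-complete {k} (∃ᵇ {r = r} p) =
    let t′ , t′∈ , t≈t′ = find (terms-complete p)
    in Any.map (trans (∃-cong t≈t′))
         (conjunctions-atom
           (∈-++⁺ʳ (map var (upTo k)) (∈-cartesianProductWith⁺ ∃⟨_⟩_ (∈-allFin r) t′∈)))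

  infixr 5 _∷ᶠ_
  _∷ᶠ_ : Term → (Var → Term) → Var → Term
  (t ∷ᶠ f) zero    = t
  (t ∷ᶠ f) (suc v) = f v

  -- Only the values below `k` are meaningful. From `k` on, `_∷ᶠ_` has shifted the tail `var`, and
  -- `cutoff` later restores the identity there.
  assignments : ℕ → List Term → List (Var → Term)
  assignments zero    ts = var ∷ []
  assignments (suc k) ts = cartesianProductWith _∷ᶠ_ ts (assignments k ts)

  assignments-complete : ∀ k {ts} (f : Var → Term) → (∀ {v} → v < k → Any (f v ≈_) ts) →
                         Any (λ g → ∀ {v} → v < k → f v ≈ g v) (assignments k ts)
  assignments-complete zero    f f∈ = here λ ()
  assignments-complete (suc k) f f∈ =
    let t , t∈ , f0≈t = find (f∈ z<s)
        g , g∈ , f≈g  = find (assignments-complete k (f ∘ suc) (f∈ ∘ s≤s))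
    in lose (∈-cartesianProductWith⁺ _∷ᶠ_ t∈ g∈) (agree f0≈t f≈g)
    where
    agree : ∀ {t g} → f 0 ≈ t → (∀ {v} → v < k → f (suc v) ≈ g v) →
            ∀ {v} → v < suc k → f v ≈ (t ∷ᶠ g) v
    agree f0≈t f≈g {zero}  _         = f0≈t
    agree f0≈t f≈g {suc v} (s≤s v<k) = f≈g v<k

  -- Substitutions obtained by truncation, and their bounds.

  cutoff : ℕ → (Var → Term) → Var → Term
  cutoff k f v = if does (v <? k) then f v else var v

  cutoff-< : ∀ {k v} (f : Var → Term) → v < k → cutoff k f v ≡ f v
  cutoff-< {k} {v} f v<k rewrite dec-true (v <? k) v<k = refl

  cutoff-≥ : ∀ {k v} (f : Var → Term) → k ≤ v → cutoff k f v ≡ var v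
  cutoff-≥ {k} {v} f k≤v rewrite dec-false (v <? k) (λ v<k → <⇒≱ v<k k≤v) = refl

  truncate : ℕ → (Var → Term) → Substitution
  truncate k f = record { fun = cutoff k f ; finiteDomain = upTo k , inDomain }
    where
    inDomain : ∀ v → cutoff k f v ≢ var v → v ∈ upTo k
    inDomain v ≢v with v <? k
    ... | yes v<k = ∈-upTo⁺ v<k
    ... | no  v≮k = contradiction (cutoff-≥ f (≮⇒≥ v≮k)) ≢v

  BoundedBy : ℕ → Pred Substitution 0ℓ
  BoundedBy k σ = (∀ {v} → k ≤ v → fun σ v ≡ var v) × (∀ {v} → v < k → Bounded k k (fun σ v))

  var? : ∀ t v → Dec (t ≡ var v)
  var? (var w)    v = map′ (≡.cong var) (λ { refl → refl }) (w ≟ v)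
  var? ⊤          v = no λ ()
  var? (_ ⊓ _)    v = no λ ()
  var? (∃⟨ _ ⟩ _) v = no λ ()

  boundˢ : Substitution → ℕ
  boundˢ σ = maximum (λ v → suc v ⊔ bound (fun σ v)) (proj₁ (finiteDomain σ))

  boundˢ-BoundedBy : ∀ σ {k} → boundˢ σ ≤ k → BoundedBy k σ
  boundˢ-BoundedBy σ {k} ≤k = outside , inside
    where
    below : ∀ {v} → fun σ v ≢ var v → suc v ⊔ bound (fun σ v) ≤ k
    below ≢v = ≤-trans (≤-maximum _ (proj₂ (finiteDomain σ) _ ≢v)) ≤k
    outside : ∀ {v} → k ≤ v → fun σ v ≡ var v
    outside {v} k≤v with var? (fun σ v) v
    ... | yes ≡v = ≡v
    ... | no  ≢v = contradiction k≤v (<⇒≱ (≤-trans (m≤m⊔n (suc v) (bound (fun σ v))) (below ≢v)))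
    inside : ∀ {v} → v < k → Bounded k k (fun σ v)
    inside {v} v<k with var? (fun σ v) v
    ... | yes ≡v rewrite ≡v = varᵇ v<k
    ... | no  ≢v = Bounded-mono ≤k′ ≤k′ (bounded (fun σ v))
      where ≤k′ = ≤-trans (m≤n⊔m (suc v) _) (below ≢v)

  -- The instantiation preorder

  infix 4 _≼_ _≼?_
  -- A record, since σ and τ could not be inferred from an unfolded σ ≤ⱽ τ.
  record _≼_ (σ τ : Substitution) : Set where
    constructor instantiates
    field
      instantiation : _≤ⱽ_ EL σ τ

  open _≼_

  ≼-refl : ∀ {σ} → σ ≼ σ
  ≼-refl {σ} = instantiates
    ( record { fun = var ; finiteDomain = [] , λ v ≢v → contradiction refl ≢v }
    , λ v → reflexive (extend-var (fun σ v)))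

  infixr 9 _∘ˢ_
  _∘ˢ_ : Substitution → Substitution → Substitution
  ρ ∘ˢ σ = truncate (boundˢ ρ ⊔ boundˢ σ) (extend (fun ρ) ∘ fun σ)

  -- Beyond both bounds each factor is the identity, so truncating the composite changes nothing.
  ∘ˢ-fun : ∀ ρ σ v → fun (ρ ∘ˢ σ) v ≡ extend (fun ρ) (fun σ v)
  ∘ˢ-fun ρ σ v with v <? boundˢ ρ ⊔ boundˢ σ
  ... | yes v<k = cutoff-< (extend (fun ρ) ∘ fun σ) v<k
  ... | no  v≮k rewrite cutoff-≥ {boundˢ ρ ⊔ boundˢ σ} (extend (fun ρ) ∘ fun σ) (≮⇒≥ v≮k)
                      | proj₁ (boundˢ-BoundedBy σ (m≤n⊔m (boundˢ ρ) _)) (≮⇒≥ v≮k)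
                      | proj₁ (boundˢ-BoundedBy ρ (m≤m⊔n _ (boundˢ σ))) (≮⇒≥ v≮k) = refl

  ≼-trans : ∀ {σ τ υ} → σ ≼ τ → τ ≼ υ → σ ≼ υ
  ≼-trans {σ} {τ} {υ} (instantiates (ρ , ρσ≈τ)) (instantiates (ρ′ , ρ′τ≈υ)) =
    instantiates (ρ′ ∘ˢ ρ , λ v → begin
    extend (fun (ρ′ ∘ˢ ρ)) (fun σ v)
      ≈⟨ extend-cong (fun σ v) (λ {w} _ → reflexive (∘ˢ-fun ρ′ ρ w)) ⟩
    extend (extend (fun ρ′) ∘ fun ρ) (fun σ v)      ≡⟨ extend-∘ (fun ρ′) (fun ρ) (fun σ v) ⟨
    extend (fun ρ′) (extend (fun ρ) (fun σ v))      ≈⟨ extend-resp-≈ (fun ρ′) (ρσ≈τ v) ⟩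
    extend (fun ρ′) (fun τ v)                       ≈⟨ ρ′τ≈υ v ⟩
    fun υ v                                         ∎)

  ≼-pointwise : ∀ {σ τ} → (∀ v → fun σ v ≈ fun τ v) → σ ≼ τ
  ≼-pointwise {σ} σ≈τ =
    let ρ , ρσ≈σ = instantiation (≼-refl {σ})
    in instantiates (ρ , λ v → trans (ρσ≈σ v) (σ≈τ v))

  BoundedBy-vars : ∀ {k} σ → BoundedBy k σ → ∀ {v w} → v < k → w ∈ vars (fun σ v) → w < k
  BoundedBy-vars σ (_ , inside) {v} v<k w∈ = Bounded-vars (fun σ v) (inside v<k) w∈

  -- From `k` on both substitutions are the identity. Below `k`, an instantiation matters only at
  -- variables of `σ`, where its values are bounded because they occur inside terms equivalent to
  -- values of `τ`. A finite search therefore suffices.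
  _≼?_ : Decidable _≼_
  σ ≼? τ = map′ sound complete (Any.any? matches? (assignments k (terms k k)))
    where
    k = boundˢ σ ⊔ boundˢ τ
    σ-bounded = boundˢ-BoundedBy σ (m≤m⊔n _ (boundˢ τ))
    τ-bounded = boundˢ-BoundedBy τ (m≤n⊔m (boundˢ σ) _)

    Matches : Pred (Var → Term) 0ℓ
    Matches g = ∀ {v} → v < k → extend (cutoff k g) (fun σ v) ≈ fun τ v

    matches? : Unary.Decidable Matches
    matches? g = allUpTo? (λ v → extend (cutoff k g) (fun σ v) ≈? fun τ v) k

    sound : Any Matches (assignments k (terms k k)) → σ ≼ τ
    sound any =
      let g , _ , matches = find any
      in instantiates (truncate k g , λ v → case v <? k of λ where
        (yes v<k) → matches v<k
        (no v≮k)  → reflexive (≡.trans (≡.cong (extend (cutoff k g)) (proj₁ σ-bounded (≮⇒≥ v≮k)))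
                      (≡.trans (cutoff-≥ g (≮⇒≥ v≮k)) (≡.sym (proj₁ τ-bounded (≮⇒≥ v≮k))))))

    complete : σ ≼ τ → Any Matches (assignments k (terms k k))
    complete (instantiates (ρ , ρσ≈τ)) =
      Any.map agree (assignments-complete k f λ {v} _ → terms-complete (f-bounded v))
      where
      f : Var → Term
      -- Unbounded values can arise only at variables missing from the values of `σ` below `k`, so
      -- the default `⊤` is harmless.
      f v = if does (bounded? k k (fun ρ v)) then fun ρ v else ⊤

      f-bounded : ∀ v → Bounded k k (f v)
      f-bounded v with bounded? k k (fun ρ v)
      ... | yes b = b
      ... | no  _ = ⊤ᵇ

      f-agrees : ∀ {v w} → v < k → w ∈ vars (fun σ v) → f w ≡ fun ρ w
      f-agrees {v} {w} v<k w∈ rewrite dec-true (bounded? k k (fun ρ w))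
        (Bounded-extend⁻ (fun σ v)
          (Bounded-resp-⊑ (≈⇒⊒ (ρσ≈τ v)) (proj₂ τ-bounded v<k)) w∈) = refl

      agree : ∀ {g} → (∀ {v} → v < k → f v ≈ g v) → Matches g
      agree {g} f≈g {v} v<k = trans (extend-cong (fun σ v) pointwise) (ρσ≈τ v)
        where
        pointwise : ∀ {w} → w ∈ vars (fun σ v) → cutoff k g w ≈ fun ρ w
        pointwise {w} w∈ = begin
          cutoff k g w  ≡⟨ cutoff-< g w<k ⟩
          g w           ≈⟨ f≈g w<k ⟨
          f w           ≡⟨ f-agrees v<k w∈ ⟩
          fun ρ w       ∎
          where w<k = BoundedBy-vars σ σ-bounded v<k w∈

  -- Candidate substitutions and bounded problems.

  candidates : ℕ → List Substitution
  candidates k = map (truncate k) (assignments k (terms k k))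

  candidates-complete : ∀ {k} σ → BoundedBy k σ →
                        Any (λ τ → ∀ v → fun σ v ≈ fun τ v) (candidates k)
  candidates-complete {k} σ (outside , inside) =
    Any.map⁺ (Any.map agree (assignments-complete k (fun σ) (terms-complete ∘ inside)))
    where
    agree : ∀ {g} → (∀ {v} → v < k → fun σ v ≈ g v) → ∀ v → fun σ v ≈ cutoff k g v
    agree {g} σ≈g v with v <? k
    ... | yes v<k = trans (σ≈g v<k) (reflexive (≡.sym (cutoff-< g v<k)))
    ... | no  v≮k = reflexive (≡.trans (outside (≮⇒≥ v≮k)) (≡.sym (cutoff-≥ g (≮⇒≥ v≮k))))

  BoundedProblem : ℕ → Pred Problem 0ℓ
  BoundedProblem k = All λ (s , t) → Bounded k k s × Bounded k k t

  boundᵖ : Problem → ℕ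
  boundᵖ = maximum λ (s , t) → bound s ⊔ bound t

  boundᵖ-BoundedProblem : ∀ Γ {k} → boundᵖ Γ ≤ k → BoundedProblem k Γ
  boundᵖ-BoundedProblem Γ ≤k = All.tabulate λ {(s , t)} ∈Γ →
    let ≤k′ = ≤-trans (≤-maximum (λ (s , t) → bound s ⊔ bound t) ∈Γ) ≤k
        s≤k = ≤-trans (m≤m⊔n (bound s) (bound t)) ≤k′
        t≤k = ≤-trans (m≤n⊔m (bound s) (bound t)) ≤k′
    in Bounded-mono s≤k s≤k (bounded s) , Bounded-mono t≤k t≤k (bounded t)

  unifier? : ∀ Γ → Unary.Decidable (Unifier EL Γ)
  unifier? Γ σ = All.all? (λ (s , t) → σ ⟪ s ⟫ ≈? σ ⟪ t ⟫) Γ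

  Unifier-resp-≼ : ∀ {Γ σ τ} → σ ≼ τ → Unifier EL Γ σ → Unifier EL Γ τ
  Unifier-resp-≼ {σ = σ} {τ} (instantiates (ρ , ρσ≈τ)) = All.map λ {(s , t)} eq → begin
    τ ⟪ s ⟫                   ≈⟨ factor s ⟩
    extend (fun ρ) (σ ⟪ s ⟫)  ≈⟨ extend-resp-≈ (fun ρ) eq ⟩
    extend (fun ρ) (σ ⟪ t ⟫)  ≈⟨ factor t ⟨
    τ ⟪ t ⟫                   ∎
    where
    factor : ∀ t → τ ⟪ t ⟫ ≈ extend (fun ρ) (σ ⟪ t ⟫)
    factor t = begin
      τ ⟪ t ⟫                              ≈⟨ extend-cong t (λ {v} _ → ρσ≈τ v) ⟨
      extend (extend (fun ρ) ∘ fun σ) t    ≡⟨ extend-∘ (fun ρ) (fun σ) t ⟨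
      extend (fun ρ) (σ ⟪ t ⟫)             ∎

  -- Minimal unifiers

  module Compression {k} {σ τ : Substitution} (τ-bounded : BoundedBy k τ) (σ≼τ : σ ≼ τ) where

    private
      ρ : Substitution
      ρ = proj₁ (instantiation σ≼τ)

      ρσ≈τ : ∀ v → ρ ⟪ fun σ v ⟫ ≈ fun τ v
      ρσ≈τ = proj₂ (instantiation σ≼τ)

      j m : ℕ
      j = boundˢ σ
      m = j + k

      σ-bounded : BoundedBy m σ
      σ-bounded = boundˢ-BoundedBy σ (m≤m+n j k)

    used : List Var
    used = deduplicate _≟_ (concatMap (vars ∘ fun σ) (upTo k))

    used⁺ : ∀ {v w} → v < k → w ∈ vars (fun σ v) → w ∈ used
    used⁺ {v} v<k w∈ =
      ∈-deduplicate⁺ _≟_ (∈-concatMap⁺ (vars ∘ fun σ) (lose (∈-upTo⁺ v<k) w∈))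

    used⁻ : ∀ {w} → w ∈ used → ∃ λ v → v < k × w ∈ vars (fun σ v)
    used⁻ w∈ =
      let v , v∈ , w∈v = find (∈-concatMap⁻ (vars ∘ fun σ) (∈-deduplicate⁻ _≟_ _ w∈))
      in v , ∈-upTo⁻ v∈ , w∈v

    bounded-ρσ : ∀ {v} → v < k → Bounded k k (ρ ⟪ fun σ v ⟫)
    bounded-ρσ {v} v<k = Bounded-resp-⊑ (≈⇒⊒ (ρσ≈τ v)) (proj₂ τ-bounded v<k)

    bounded-ρ : ∀ {w} → w ∈ used → Bounded k k (fun ρ w)
    bounded-ρ w∈ = let v , v<k , w∈v = used⁻ w∈ in Bounded-extend⁻ (fun σ v) (bounded-ρσ v<k) w∈v

    -- Since `τ` fixes `i + k`, the image of `σ` at `i + k` instantiates to a variable, which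
    -- `var-preimage` traces back.
    spare-spec : ∀ i → ∃ λ w → w ∈ vars (fun σ (i + k)) × fun ρ w ≈ var (i + k)
    spare-spec i = var-preimage (fun σ (i + k))
      (trans (ρσ≈τ (i + k)) (reflexive (proj₁ τ-bounded (m≤n+m k i))))

    spare : ℕ → Var
    spare i = proj₁ (spare-spec i)

    ρ-spare : ∀ i → fun ρ (spare i) ≈ var (i + k)
    ρ-spare i = proj₂ (proj₂ (spare-spec i))

    spare-injective : ∀ {i i′} → spare i ≡ spare i′ → i ≡ i′
    spare-injective {i} {i′} eq = +-cancelʳ-≡ k i i′ (var-injective
      (trans (sym (ρ-spare i)) (trans (reflexive (≡.cong (fun ρ) eq)) (ρ-spare i′))))

    -- On used variables the values of `ρ` only contain variables below `k`, whereas `spare i` is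
    -- sent to `i + k`.
    spare∉used : ∀ i → spare i ∉ used
    spare∉used i spare∈
      with varᵇ i+k<k ← Bounded-resp-⊑ (≈⇒⊑ (ρ-spare i)) (bounded-ρ spare∈) =
      <⇒≱ i+k<k (m≤n+m k i)

    spare<m : ∀ {i} → i < j → spare i < m
    spare<m {i} i<j =
      BoundedBy-vars σ σ-bounded (+-monoˡ-< k i<j) (proj₁ (proj₂ (spare-spec i)))

    used<m : ∀ {w} → w ∈ used → w < m
    used<m w∈ =
      let v , v<k , w∈v = used⁻ w∈
      in BoundedBy-vars σ σ-bounded (<-≤-trans v<k (m≤n+m k j)) w∈v

    -- The variables `spare i` for `i < j` and the used ones are pairwise distinct and all lie below
    -- `m = j + k`, which leaves room for at most `k` used ones.
    length-used : length used ≤ k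
    length-used = +-cancelˡ-≤ j (length used) k (≤-trans (≤-reflexive count)
      (unique-length-≤ unique
        (All.++⁺ (All.map⁺ (All.tabulate (spare<m ∘ ∈-upTo⁻))) (All.tabulate used<m))))
      where
      count : j + length used ≡ length (map spare (upTo j) ++ used)
      count = ≡.sym (≡.trans (length-++ (map spare (upTo j)))
        (≡.cong (_+ length used) (≡.trans (length-map spare (upTo j)) (length-upTo j))))

      unique : Propositional.Unique (map spare (upTo j) ++ used)
      unique = Unique.++⁺ (Unique.map⁺ spare-injective (Unique.upTo⁺ j)) (deduplicate-! _≟_ _)
        λ (v∈spare , v∈used) → case ∈-map⁻ spare v∈spare of λ where
          (i , _ , refl) → spare∉used i v∈used

    position : Var → Var
    position w with mem? _≟_ w used
    ... | yes w∈ = toℕ (Any.index w∈)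
    ... | no  _  = w

    position<k : ∀ {w} → w ∈ used → position w < k
    position<k {w} w∈ with mem? _≟_ w used
    ... | yes w∈ = <-≤-trans (Fin.toℕ<n _) length-used
    ... | no  w∉ = contradiction w∈ w∉

    -- Inverts `position` on the indices of `used`. Elsewhere it follows `σ`, since from `k` on
    -- `compressed` is the identity and the instantiation itself has to reproduce `σ`.
    occupant : Var → Term
    occupant v with v <? length used
    ... | yes v<l = var (lookup used (fromℕ< v<l))
    ... | no  _   = fun σ v

    occupant-≥ : ∀ {v} → k ≤ v → occupant v ≡ fun σ v
    occupant-≥ {v} k≤v with v <? length used
    ... | yes v<l = contradiction (<-≤-trans v<l (≤-trans length-used k≤v)) (<-irrefl refl)
    ... | no  _   = refl

    occupant-position : ∀ {w} → w ∈ used → occupant (position w) ≡ var w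
    occupant-position {w} w∈ with mem? _≟_ w used
    ... | no  w∉ = contradiction w∈ w∉
    ... | yes w∈ with toℕ (Any.index w∈) <? length used
    ...   | yes i<l = ≡.cong var (≡.trans (≡.cong (lookup used) (Fin.fromℕ<-toℕ _ i<l))
                        (≡.sym (Any.lookup-index w∈)))
    ...   | no  i≮l = contradiction (Fin.toℕ<n _) i≮l

    compressed : Substitution
    compressed = truncate k (extend (var ∘ position) ∘ fun σ)

    compressed-< : ∀ {v} → v < k → fun compressed v ≡ extend (var ∘ position) (fun σ v)
    compressed-< = cutoff-< (extend (var ∘ position) ∘ fun σ)

    compressed-bounded : BoundedBy k compressed
    compressed-bounded = cutoff-≥ (extend (var ∘ position) ∘ fun σ) , λ {v} v<k →
      ≡.subst (Bounded k k) (≡.sym (compressed-< v<k))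
        (Bounded-rename (fun σ v) (bounded-ρσ v<k) (position<k ∘ used⁺ v<k))

    -- The problem only mentions variables below `k`, where `compressed` is `σ` followed by a
    -- renaming.
    compressed-unifier : ∀ {Γ} → BoundedProblem k Γ → Unifier EL Γ σ → Unifier EL Γ compressed
    compressed-unifier Γ-bounded σ-unifies = All.zipWith (λ {(s , t)} ((bs , bt) , eq) → begin
      compressed ⟪ s ⟫                        ≈⟨ renamed s bs ⟩
      extend (var ∘ position) (σ ⟪ s ⟫)       ≈⟨ extend-resp-≈ (var ∘ position) eq ⟩
      extend (var ∘ position) (σ ⟪ t ⟫)       ≈⟨ renamed t bt ⟨
      compressed ⟪ t ⟫                        ∎) (Γ-bounded , σ-unifies)
      where
      renamed : ∀ t → Bounded k k t → compressed ⟪ t ⟫ ≈ extend (var ∘ position) (σ ⟪ t ⟫)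
      renamed t b = trans
        (extend-cong t (λ v∈ → reflexive (compressed-< (Bounded-vars t b v∈))))
        (reflexive (≡.sym (extend-∘ (var ∘ position) (fun σ) t)))

    compressed≼σ : compressed ≼ σ
    compressed≼σ = instantiates (truncate m occupant , restores)
      where
      -- From `m` on, `occupant` agrees with `σ`, which is the identity there.
      cutoff-occupant : ∀ v → cutoff m occupant v ≡ occupant v
      cutoff-occupant v with v <? m
      ... | yes v<m = cutoff-< occupant v<m
      ... | no  v≮m =
        let m≤v = ≮⇒≥ v≮m
        in ≡.trans (cutoff-≥ occupant m≤v)
             (≡.sym (≡.trans (occupant-≥ (≤-trans (m≤n+m k j) m≤v)) (proj₁ σ-bounded m≤v)))

      restores : ∀ v → extend (cutoff m occupant) (fun compressed v) ≈ fun σ v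
      restores v with v <? k
      ... | no  v≮k = reflexive (≡.trans
              (≡.cong (extend (cutoff m occupant)) (proj₁ compressed-bounded (≮⇒≥ v≮k)))
              (≡.trans (cutoff-occupant v) (occupant-≥ (≮⇒≥ v≮k))))
      ... | yes v<k = begin
        extend (cutoff m occupant) (fun compressed v)
          ≡⟨ ≡.cong (extend (cutoff m occupant)) (compressed-< v<k) ⟩
        extend (cutoff m occupant) (extend (var ∘ position) (fun σ v))
          ≡⟨ extend-∘ (cutoff m occupant) (var ∘ position) (fun σ v) ⟩
        extend (cutoff m occupant ∘ position) (fun σ v)
          ≈⟨ extend-cong (fun σ v) (λ {w} w∈ → reflexive
               (≡.trans (cutoff-occupant (position w)) (occupant-position (used⁺ v<k w∈)))) ⟩
        extend var (fun σ v)
          ≡⟨ extend-var (fun σ v) ⟩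
        fun σ v ∎

  module Minimal (Γ : Problem) where

    MinimalUnifier : Pred Substitution 0ℓ
    MinimalUnifier σ = Unifier EL Γ σ × (∀ {τ} → Unifier EL Γ τ → τ ≼ σ → σ ≼ τ)

    -- Minimality against the finitely many candidates suffices: any unifier `τ` below `σ` is also
    -- below `θ`, so it compresses, with the bounds of `θ`, to a unifier below `τ` that is
    -- equivalent to a candidate.
    minimal-unifier-below : ∀ θ → Unifier EL Γ θ → ∃ λ σ → MinimalUnifier σ × σ ≼ θ
    minimal-unifier-below θ θ-unifies =
      let σ , σ-unifies , σ≼θ , σ-minimal =
            minimal-below {_≲_ = _≼_} ≼-refl ≼-trans _≼?_
              (filter (unifier? Γ) (candidates k)) (All.all-filter (unifier? Γ) (candidates k))
              θ-unifies
      in σ , (σ-unifies , λ {τ} τ-unifies τ≼σ →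
        let open Compression θ-bounded (≼-trans τ≼σ σ≼θ)
            c , c∈ , τ′≈c = find (candidates-complete compressed compressed-bounded)
            c-unifies     = Unifier-resp-≼ (≼-pointwise {compressed} {c} τ′≈c)
                              (compressed-unifier Γ-bounded τ-unifies)
            c≼τ           = ≼-trans (≼-pointwise (sym ∘ τ′≈c)) compressed≼σ
            σ≼c           = σ-minimal (∈-filter⁺ (unifier? Γ) c∈ c-unifies) (≼-trans c≼τ τ≼σ)
        in ≼-trans σ≼c c≼τ) , σ≼θ
      where
      k = boundᵖ Γ ⊔ boundˢ θ
      Γ-bounded = boundᵖ-BoundedProblem Γ (m≤m⊔n _ (boundˢ θ))
      θ-bounded = boundˢ-BoundedBy θ (m≤n⊔m (boundᵖ Γ) _)

    -- Canonical representatives of equivalence classes.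

    infix 4 _~_
    _~_ : Rel Substitution 0ℓ
    σ ~ τ = σ ≼ τ × τ ≼ σ

    ~-sym : ∀ {σ τ} → σ ~ τ → τ ~ σ
    ~-sym (p , q) = q , p

    ~-trans : ∀ {σ τ υ} → σ ~ τ → τ ~ υ → σ ~ υ
    ~-trans (p , q) (p′ , q′) = ≼-trans p p′ , ≼-trans q′ q

    _~?_ : Decidable _~_
    σ ~? τ = σ ≼? τ ×-dec τ ≼? σ

    Listed : Substitution → Pred ℕ 0ℓ
    Listed σ k = Any (_~ σ) (candidates k)

    Listed-resp-~ : ∀ {σ τ k} → σ ~ τ → Listed σ k → Listed τ k
    Listed-resp-~ σ~τ = Any.map λ c~σ → ~-trans c~σ σ~τ

    -- The least stage at which the class of `σ` is listed, and the first member listed there,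
    -- depend on the class alone; each class thus has exactly one such element.
    Canonical : Pred Substitution 0ℓ
    Canonical σ = ∃ λ k → IsFirst (_~ σ) σ (candidates k) × (∀ {j} → j < k → ¬ Listed σ j)

    canonical : ∀ σ → ∃ λ τ → Canonical τ × τ ~ σ
    canonical σ =
      let k , listed , earlier = least listed? listed-at-bound
          τ , isFirst          = first (_~? σ) listed
          τ~σ                  = first-satisfies isFirst
      in τ
       , (k , first-map (λ υ~σ → ~-trans υ~σ (~-sym τ~σ)) (λ υ~τ → ~-trans υ~τ τ~σ) isFirst
            , λ j<k → earlier j<k ∘ Listed-resp-~ τ~σ)
       , τ~σ
      where
      listed? : Unary.Decidable (Listed σ)
      listed? k = Any.any? (_~? σ) (candidates k)

      listed-at-bound : Listed σ (boundˢ σ)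
      listed-at-bound = Any.map (λ σ≈c → ≼-pointwise (sym ∘ σ≈c) , ≼-pointwise σ≈c)
        (candidates-complete σ (boundˢ-BoundedBy σ ≤-refl))

    canonical-unique : ∀ {σ τ} → σ ~ τ → Canonical σ → Canonical τ → σ ≡ τ
    canonical-unique σ~τ (k , σ-first , σ-least) (l , τ-first , τ-least) with <-cmp k l
    ... | tri< k<l _ _ = contradiction (lose (first-∈ σ-first) σ~τ) (τ-least k<l)
    ... | tri> _ _ l<k = contradiction (lose (first-∈ τ-first) (~-sym σ~τ)) (σ-least l<k)
    ... | tri≈ _ refl _ = first-unique
      (first-map (λ υ~σ → ~-trans υ~σ σ~τ) (λ υ~τ → ~-trans υ~τ (~-sym σ~τ)) σ-first) τ-first

    CanonicalMinimal : Pred Substitution 0ℓ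
    CanonicalMinimal σ = MinimalUnifier σ × Canonical σ

    canonical-minimalComplete : IsMinimalComplete EL Γ CanonicalMinimal
    canonical-minimalComplete = record
      { sound    = proj₁ ∘ proj₁
      ; complete = λ θ θ-unifies →
          let σ , (σ-unifies , σ-minimal) , σ≼θ = minimal-unifier-below θ θ-unifies
              τ , τ-canonical , τ≼σ , σ≼τ       = canonical σ
          in τ , ((Unifier-resp-≼ σ≼τ σ-unifies ,
                   λ υ-unifies υ≼τ → ≼-trans τ≼σ (σ-minimal υ-unifies (≼-trans υ≼τ τ≼σ)))
                 , τ-canonical)
               , instantiation (≼-trans τ≼σ σ≼θ)
      -- Minimality of `τ` turns comparability into equivalence, and equivalent canonical elements
      -- coincide.
      ; minimal  = λ σ τ ((σ-unifies , _) , σ-canonical) ((_ , τ-minimal) , τ-canonical) σ≢τ σ≤τ →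
          let σ≼τ = instantiates σ≤τ in σ≢τ λ v → ≡.cong (λ υ → fun υ v)
            (canonical-unique (σ≼τ , τ-minimal σ-unifies σ≼τ) σ-canonical τ-canonical)
      }

  -- A problem without finite complete sets

  module InfiniteExample (r : Role) where

    Γ : Problem
    Γ = (∃⟨ r ⟩ var 1 ⊓ var 0 , ∃⟨ r ⟩ var 1) ∷ []

    ⋀ : (Var → Term) → ℕ → Term
    ⋀ f zero    = ⊤
    ⋀ f (suc m) = f m ⊓ ⋀ f m

    ⋀-⊑ : ∀ {f m v} → v < m → ⋀ f m ⊑ f v
    ⋀-⊑ {m = suc m} v<1+m with m<1+n⇒m<n∨m≡n v<1+m
    ... | inj₁ v<m  = ⊓ˡ₂ (⋀-⊑ v<m)
    ... | inj₂ refl = ⊓ˡ₁ ⊑-refl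

    ⊑-⋀ : ∀ {s f} m → (∀ {v} → v < m → s ⊑ f v) → s ⊑ ⋀ f m
    ⊑-⋀ zero    s⊑f = ⊤ʳ
    ⊑-⋀ (suc m) s⊑f = ⊓ʳ (s⊑f (n<1+n m)) (⊑-⋀ m λ v<m → s⊑f (<-≤-trans v<m (n≤1+n m)))

    ⋀-⊑-∃⁻ : ∀ {f r t} m → ⋀ f m ⊑ ∃⟨ r ⟩ t → ∃ λ v → f v ⊑ ∃⟨ r ⟩ t
    ⋀-⊑-∃⁻ (suc m) p = [ (m ,_) , ⋀-⊑-∃⁻ m ]′ (⊓-⊑-∃⁻ p)

    -- The variables `z_j` are `0`, ..., `m − 1` themselves; reusing `0` and `1` is safe, as images
    -- are not substituted into again. Truncation at 2 keeps the constant tail only at variable 1.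
    θ : ℕ → Substitution
    θ m = truncate 2 (⋀ (λ v → ∃⟨ r ⟩ var v) m ∷ᶠ λ _ → ⋀ var m)

    θ-unifies : ∀ m → Unifier EL Γ (θ m)
    θ-unifies m =
      ⊑-antisym (⊓ˡ₁ ⊑-refl) (⊓ʳ ⊑-refl (⊑-⋀ m (λ v<m → ∃ᵐ (⋀-⊑ v<m)))) ∷ []

    -- The hypothesis ∃⟨ r ⟩ s ⊑ t says that t has no variable at top level.
    ∃-preimage : ∀ {ρ : Var → Term} {s u} t → ∃⟨ r ⟩ s ⊑ t → extend ρ t ⊑ ∃⟨ r ⟩ u →
                 ∃ λ c → (∀ {v} → v ∈ vars c → v ∈ vars t) ×
                         extend ρ t ⊑ ∃⟨ r ⟩ extend ρ c × extend ρ c ⊑ u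
    ∃-preimage (s ⊓ t) p q with ⊓-⊑-∃⁻ q
    ... | inj₁ q′ =
      let c , c⊆ , ρs⊑ , ρc⊑ = ∃-preimage s (proj₁ (⊑-⊓⁻ p)) q′
      in c , ∈-++⁺ˡ ∘ c⊆ , ⊓ˡ₁ ρs⊑ , ρc⊑
    ... | inj₂ q′ =
      let c , c⊆ , ρt⊑ , ρc⊑ = ∃-preimage t (proj₂ (⊑-⊓⁻ p)) q′
      in c , ∈-++⁺ʳ (vars s) ∘ c⊆ , ⊓ˡ₂ ρt⊑ , ρc⊑
    ∃-preimage (∃⟨ _ ⟩ t) p (∃ᵐ q) = t , id , ⊑-refl , q

    -- As `σ` unifies, `fun σ 0` has no variable at top level, so the conjunct for `v` comes from
    -- some `∃⟨ r ⟩ c` in it, up to instantiation by `ρ`.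
    θ-preimage : ∀ {σ m v} → Unifier EL Γ σ → ((ρ , _) : _≤ⱽ_ EL σ (θ m)) → v < m →
                 ∃ λ w → w ∈ vars (fun σ 0) × fun ρ w ≈ var v
    θ-preimage {σ} {m} {v} (eq ∷ []) (ρ , ρσ≈θ) v<m
      with c , c⊆ , ρσ0⊑ , ρc⊑v ← ∃-preimage (fun σ 0) (proj₂ (⊑-⊓⁻ (≈⇒⊒ eq)))
                                   (⊑-trans (≈⇒⊑ (ρσ≈θ 0)) (⋀-⊑ v<m))
      -- Conversely, the instance of `c` lies above some variable `w`; squeezed between `w` and `v`,
      -- it forces `w` to be `v` and is itself equivalent to `v`.
      with w , ∃ᵐ w⊑ρc ← ⋀-⊑-∃⁻ m (⊑-trans (≈⇒⊒ (ρσ≈θ 0)) ρσ0⊑)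
      with varᵐ ← ⊑-trans w⊑ρc ρc⊑v =
      let y , y∈ , ρy≈ = var-preimage c (⊑-antisym ρc⊑v w⊑ρc) in y , c⊆ y∈ , ρy≈

    -- The preimages of the `m` variables are distinct because `ρ` recovers each one, and they all
    -- lie below the bound.
    θ-bound : ∀ {σ m} → Unifier EL Γ σ → _≤ⱽ_ EL σ (θ m) → m ≤ bound (fun σ 0)
    θ-bound {σ} {m} σ-unifies σ≼θ@(ρ , _) = Fin.injective⇒≤ {f = f} λ {i} {j} eq →
      Fin.toℕ-injective (var-injective (trans (sym (ρ-preimage i))
        (trans (reflexive (≡.cong (fun ρ) (Fin.fromℕ<-injective _ _ (below i) (below j) eq)))
          (ρ-preimage j))))
      where
      preimage : (i : Fin m) → ∃ λ w → w ∈ vars (fun σ 0) × fun ρ w ≈ var (toℕ i)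
      preimage i = θ-preimage {σ} {m} σ-unifies σ≼θ (Fin.toℕ<n i)

      ρ-preimage : ∀ i → fun ρ (proj₁ (preimage i)) ≈ var (toℕ i)
      ρ-preimage i = proj₂ (proj₂ (preimage i))

      below : ∀ i → proj₁ (preimage i) < bound (fun σ 0)
      below i = Bounded-vars (fun σ 0) (bounded (fun σ 0)) (proj₁ (proj₂ (preimage i)))

      f : Fin m → Fin (bound (fun σ 0))
      f i = fromℕ< (below i)

    complete⇒infinite : ∀ {S} → IsMinimalComplete EL Γ S → Infinite S
    complete⇒infinite S-complete (_ , σs , _ , _ , _ , covers) =
      let open IsMinimalComplete S-complete
          m              = maximum (λ σ → bound (fun σ 0)) σs
          -- One conjunct more than any listed substitution can accommodate.
          σ , Sσ , σ≼θ   = complete (θ (suc m)) (θ-unifies (suc m))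
          τ , τ∈ , σ≗τ   = find (covers σ Sσ)
          m<             = θ-bound {σ} {suc m} (sound Sσ) σ≼θ
      in <⇒≱ (≡.subst (λ t → m < bound t) (σ≗τ 0) m<) (≤-maximum (λ σ → bound (fun σ 0)) τ∈)

theorem6p16 : (n : ℕ) .{{_ : NonZero n}} → Unification.TheoryHasType n (Unification.EL n) infinitary
theorem6p16 n@(suc _) = record
  { attained = Γ , (θ 0 , θ-unifies 0) , CanonicalMinimal Γ , canonical-minimalComplete Γ ,
               complete⇒infinite (canonical-minimalComplete Γ)
  ; bound    = λ where
      Γ _ unitary    _    → z≤n
      Γ _ finitary   _    → s≤s z≤n
      Γ _ infinitary _    → ≤-refl
      -- Type zero is refuted uniformly, by the canonical minimal unifiers of the problem.
      Γ _ zero       none → contradiction (CanonicalMinimal Γ , canonical-minimalComplete Γ) none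
  }
  where
  -- The pattern `suc _` guarantees a role name for the example.
  open InfiniteExample n Fin.zero
  open Minimal n
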